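{- Every preproof of $\mathsf{G}^\infty$ is a proof of $\mathsf{G}^\infty$.
   Context: Formulas: $\phi ::= p \mid \bot \mid \phi\to\phi \mid \phi\rhd\phi$. A sequent $\Gamma\Rightarrow\Delta$ is a pair of finite multisets of formulas; commas denote multiset union; $\Sigma\rhd\bot := \{\sigma\rhd\bot:\sigma\in\Sigma\}$; for formulas $\phi_0,\dots,\phi_{m-1}$, $\Phi_{[0,i)} := \{\phi_0,\dots,\phi_{i-1}\}$. Rules: (ax) $p,\Gamma\Rightarrow p,\Delta$ for a variable $p$; ($\bot$L) $\bot,\Gamma\Rightarrow\Delta$; ($\bot$R) from $\Gamma\Rightarrow\Delta$ infer $\Gamma\Rightarrow\bot,\Delta$; ($\to$L) from $\Gamma\Rightarrow\Delta,\phi$ and $\psi,\Gamma\Rightarrow\Delta$ infer $\phi\to\psi,\Gamma\Rightarrow\Delta$; ($\to$R) from $\phi,\Gamma\Rightarrow\Delta,\psi$ infer $\Gamma\Rightarrow\Delta,\phi\to\psi$; ($\rhd_{\mathsf{IK4}}$) for $m\ge0$: from the premises $\psi_i,(\Phi_{[0,i)},\phi)\rhd\bot\Rightarrow\Phi_{[0,i)},\phi$ ($i=0,\dots,m$) infer $\phi_0\rhd\psi_0,\dots,\phi_{m-1}\rhd\psi_{m-1},\Gamma\Rightarrow\psi_m\rhd\phi,\Delta$. A preproof of $\mathsf{G}^\infty$ is a possibly infinite, finitely branching tree whose nodes are labelled with sequents and rules among ax, $\bot$L, $\bot$R, $\to$L, $\to$R, $\rhd_{\mathsf{IK4}}$ such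 that each node with its children is an instance of its rule (so every leaf is ax or $\bot$L). A proof of $\mathsf{G}^\infty$ is a preproof in which every infinite branch passes infinitely often from the conclusion of a $\rhd_{\mathsf{IK4}}$ instance to one of its premises. -}

module Defs where

open import Data.Nat using (ℕ; zero; suc; _≤_)
open import Data.Fin using (Fin)
open import Data.List using (List; []; _∷_; _++_; map; take; length; lookup; zip; upTo; _∷ʳ_)
open import Data.List.Relation.Binary.Permutation.Propositional using (_↭_)
open import Relation.Binary.PropositionalEquality using (_≡_)
open import Data.Product using (_×_; _,_; Σ; ∃; uncurry; proj₁; proj₂)

infixr 6 _⇒_
infix 7 _▷_

data Fm : Set where
  var : ℕ → Fm
  ⊥ᶠ  : Fm
  _⇒_ : Fm → Fm → Fm
  _▷_ : Fm → Fm → Fm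

-- A sequent Γ ⇒ Δ; multisets are represented by lists, considered up to
-- permutation (_↭_) in the conclusions of rule instances.
Seq : Set
Seq = List Fm × List Fm

_▷⊥ : List Fm → List Fm
Σs ▷⊥ = map (λ σ → σ ▷ ⊥ᶠ) Σs

-- premises of the IK4 rule: for i = 0..m,
--   ψ_i , (Φ_[0,i) , φ) ▷ ⊥  ⇒  Φ_[0,i) , φ
-- where ps = [(φ_0,ψ_0),…,(φ_{m-1},ψ_{m-1})] and ψ_m = ψ.
rhdPremise : List Fm → Fm → ℕ × Fm → Seq
rhdPremise φs φ (i , χ) = (χ ∷ ((take i φs ∷ʳ φ) ▷⊥)) , (take i φs ∷ʳ φ)

rhdPremises : List (Fm × Fm) → Fm → Fm → List Seq
rhdPremises ps ψ φ =
  map (rhdPremise (map proj₁ ps) φ)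
      (zip (upTo (suc (length ps))) (map proj₂ ps ∷ʳ ψ))

data Inst : Seq → List Seq → Set where
  ax   : ∀ {Γ Δ Γ' Δ'} (p : ℕ) → Γ ↭ (var p ∷ Γ') → Δ ↭ (var p ∷ Δ') →
         Inst (Γ , Δ) []
  ⊥L   : ∀ {Γ Δ Γ'} → Γ ↭ (⊥ᶠ ∷ Γ') → Inst (Γ , Δ) []
  ⊥R   : ∀ {Γ Δ Δ'} → Δ ↭ (⊥ᶠ ∷ Δ') → Inst (Γ , Δ) ((Γ , Δ') ∷ [])
  ⇒L   : ∀ {Γ Δ Γ'} (φ ψ : Fm) → Γ ↭ ((φ ⇒ ψ) ∷ Γ') →
         Inst (Γ , Δ) ((Γ' , (Δ ∷ʳ φ)) ∷ ((ψ ∷ Γ') , Δ) ∷ [])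
  ⇒R   : ∀ {Γ Δ Δ'} (φ ψ : Fm) → Δ ↭ ((φ ⇒ ψ) ∷ Δ') →
         Inst (Γ , Δ) (((φ ∷ Γ) , (Δ' ∷ʳ ψ)) ∷ [])
  ▷IK4 : ∀ {Γ Δ Γ' Δ'} (ps : List (Fm × Fm)) (ψ φ : Fm) →
         Γ ↭ (map (uncurry _▷_) ps ++ Γ') → Δ ↭ ((ψ ▷ φ) ∷ Δ') →
         Inst (Γ , Δ) (rhdPremises ps ψ φ)

data IsRhd : ∀ {s ps} → Inst s ps → Set where
  isRhd : ∀ {Γ Δ Γ' Δ'} {ps : List (Fm × Fm)} {ψ φ : Fm}
          {e : Γ ↭ (map (uncurry _▷_) ps ++ Γ')} {f : Δ ↭ ((ψ ▷ φ) ∷ Δ')} →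
          IsRhd (▷IK4 ps ψ φ e f)

-- Without coinductive types (not admitted here), a possibly infinite tree is
-- presented by a coalgebra: a family of node-states indexed by their sequent,
-- a root state, and for each state the rule instance applied there together
-- with the child state for each premise. The preproof is the unfolding of
-- this coalgebra from the root.
Step : (Node : Seq → Set) → Seq → Set
Step Node t = Σ (List Seq) λ ps → Inst t ps × ((i : Fin (length ps)) → Node (lookup ps i))

record Preproof (s : Seq) : Set₁ where
  field
    Node : Seq → Set
    root : Node s
    step : ∀ {t} → Node t → Step Node t
open Preproof public

module _ {s : Seq} (π : Preproof s) where
  Pt : Set
  Pt = Σ Seq (Node π)

  premsOf : Pt → List Seq
  premsOf (t , x) = proj₁ (step π x)

  instOf : (x : Pt) → Inst (proj₁ x) (premsOf x)
  instOf (t , x) = proj₁ (proj₂ (step π x))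

  child : (x : Pt) → Fin (length (premsOf x)) → Pt
  child (t , x) i = lookup (premsOf (t , x)) i , proj₂ (proj₂ (step π x)) i

  record Branch : Set where
    field
      pt    : ℕ → Pt
      start : pt 0 ≡ (s , root π)
      next  : ∀ n → ∃ λ (i : Fin (length (premsOf (pt n)))) → child (pt n) i ≡ pt (suc n)
  open Branch public

  IsProof : Set
  IsProof = (b : Branch) → ∀ n → ∃ λ k → n ≤ k × IsRhd (instOf (pt b k))

{-# OPTIONS --safe #-}
-- Every rule of G^∞ other than ▷_IK4 has premises of strictly smaller total
-- formula size than its conclusion. Along an infinite branch the size can
-- therefore only decrease finitely often in a row, so the branch must pass
-- through a ▷_IK4 instance after any given point.
module Submission where

open import Defs
open import Data.Nat using (ℕ; _+_; _≤_; _<_; z≤n; s≤s)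
open import Data.Nat.Induction using (<-wellFounded)
open import Data.Nat.ListAction using (sum)
open import Data.Nat.ListAction.Properties using (sum-++; sum-↭)
open import Data.Nat.Properties
  using (≤-refl; <⇒≤; +-monoˡ-<; +-monoʳ-≤; +-mono-≤; +-identityʳ; ≤-reflexive)
open import Data.Fin using (zero; suc)
open import Data.List using (List; []; _∷_; _++_; _∷ʳ_; [_]; map; lookup)
open import Data.List.Properties using (map-++)
open import Data.List.Relation.Binary.Permutation.Propositional
  using (_↭_; ↭-sym; ↭-refl; ↭-trans; prep)
open import Data.List.Relation.Binary.Permutation.Propositional.Properties
  using (++⁺ˡ; ++⁺ʳ; shift; ∷↭∷ʳ; map⁺)
open import Induction.WellFounded using (Acc; acc)
open import Relation.Binary.PropositionalEquality using (_≡_; subst)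
open import Data.Product using (∃; _×_; _,_; proj₁)
open import Data.Sum using (_⊎_; inj₁; inj₂)
open import Function using (_∘_)

no-infinite-descent : ∀ {P : ℕ → Set} (f : ℕ → ℕ) →
                      (∀ n → P n ⊎ f (1 + n) < f n) →
                      ∀ n → ∃ λ k → n ≤ k × P k
no-infinite-descent {P} f P-or-descent n = go n (<-wellFounded (f n))
  where
  go : ∀ n → Acc _<_ (f n) → ∃ λ k → n ≤ k × P k
  go n (acc rec) with P-or-descent n
  ... | inj₁ pₙ = n , ≤-refl , pₙ
  ... | inj₂ f↓ with go (1 + n) (rec f↓)
  ...   | k , n<k , pₖ = k , <⇒≤ n<k , pₖ

size : Fm → ℕ
size (var _) = 1
size ⊥ᶠ = 1
size (φ ⇒ ψ) = 1 + (size φ + size ψ)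
size (φ ▷ ψ) = 1 + (size φ + size ψ)

sizes : List Fm → ℕ
sizes Γ = sum (map size Γ)

weight : Seq → ℕ
weight (Γ , Δ) = sizes (Γ ++ Δ)

sizes-↭ : ∀ {Γ Γ'} → Γ ↭ Γ' → sizes Γ ≡ sizes Γ'
sizes-↭ p = sum-↭ (map⁺ size p)

sizes-++ : ∀ Γ Δ → sizes (Γ ++ Δ) ≡ sizes Γ + sizes Δ
sizes-++ Γ Δ rewrite map-++ size Γ Δ = sum-++ (map size Γ) (map size Δ)

sizes-replace-lighter : ∀ {Ξ Ξ' χ} (Θ R : List Fm) → Ξ' ↭ Θ ++ R → Ξ ↭ χ ∷ R →
                        sizes Θ < size χ → sizes Ξ' < sizes Ξ
sizes-replace-lighter Θ R p q Θ<χ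
  rewrite sizes-↭ p | sizes-↭ q | sizes-++ Θ R = +-monoˡ-< (sizes R) Θ<χ

↭-to-front : ∀ (Γ : List Fm) {Δ Δ' χ} → Δ ↭ χ ∷ Δ' → Γ ++ Δ ↭ χ ∷ Γ ++ Δ'
↭-to-front Γ {Δ' = Δ'} {χ} p = ↭-trans (++⁺ˡ Γ p) (shift χ Γ Δ')

∷ʳ-to-front : ∀ (Γ Δ : List Fm) φ → Γ ++ (Δ ∷ʳ φ) ↭ φ ∷ Γ ++ Δ
∷ʳ-to-front Γ Δ φ = ↭-to-front Γ (↭-sym (∷↭∷ʳ φ Δ))

rhd-or-premises-lighter : ∀ {t ps} (ι : Inst t ps) →
                          IsRhd ι ⊎ (∀ i → weight (lookup ps i) < weight t)
rhd-or-premises-lighter (ax _ _ _) = inj₂ λ ()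
rhd-or-premises-lighter (⊥L _) = inj₂ λ ()
rhd-or-premises-lighter {Γ , _} (⊥R {Δ' = Δ'} p) = inj₂ λ
  { zero → sizes-replace-lighter [] (Γ ++ Δ') ↭-refl (↭-to-front Γ p) (s≤s z≤n) }
rhd-or-premises-lighter {_ , Δ} (⇒L {Γ' = Γ'} φ ψ p) = inj₂ λ
  { zero → sizes-replace-lighter [ φ ] (Γ' ++ Δ) (∷ʳ-to-front Γ' Δ φ) (++⁺ʳ Δ p)
             (s≤s (+-monoʳ-≤ (size φ) z≤n))
  ; (suc zero) → sizes-replace-lighter [ ψ ] (Γ' ++ Δ) ↭-refl (++⁺ʳ Δ p)
             (s≤s (+-mono-≤ z≤n (≤-reflexive (+-identityʳ (size ψ))))) }
rhd-or-premises-lighter {Γ , _} (⇒R {Δ' = Δ'} φ ψ p) = inj₂ λ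
  { zero → sizes-replace-lighter (φ ∷ ψ ∷ []) (Γ ++ Δ')
             (prep φ (∷ʳ-to-front Γ Δ' ψ)) (↭-to-front Γ p)
             (s≤s (+-monoʳ-≤ (size φ) (≤-reflexive (+-identityʳ (size ψ))))) }
rhd-or-premises-lighter (▷IK4 _ _ _ _ _) = inj₁ isRhd

mainTheorem18 : ∀ {s : Seq} (π : Preproof s) → IsProof π
mainTheorem18 π b = no-infinite-descent (weight ∘ proj₁ ∘ pt b) rhd-or-lighter-child
  where
  rhd-or-lighter-child : ∀ n → IsRhd (instOf π (pt b n))
                               ⊎ weight (proj₁ (pt b (1 + n))) < weight (proj₁ (pt b n))
  rhd-or-lighter-child n with rhd-or-premises-lighter (instOf π (pt b n)) | next b n
  ... | inj₁ rhd     | _      = inj₁ rhd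
  ... | inj₂ lighter | i , eq = inj₂ (subst (λ x → weight (proj₁ x) < _) eq (lighter i))
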